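{- Let $a,b,c,d$ be commuting indeterminates. For a partition $\lambda=(\lambda_1,\lambda_2,\dots)$ (with $\lambda_m=0$ for $m$ larger than the number of parts), define \[ \alpha(\lambda)=\sum_{i\ge 1}\lceil \lambda_{2i-1}/2\rceil,\quad \beta(\lambda)=\sum_{i\ge1}\lfloor \lambda_{2i-1}/2\rfloor,\quad \gamma(\lambda)=\sum_{i\ge1}\lceil \lambda_{2i}/2\rceil,\quad \delta(\lambda)=\sum_{i\ge1}\lfloor \lambda_{2i}/2\rfloor, \] and $w(\lambda)=a^{\alpha(\lambda)}b^{\beta(\lambda)}c^{\gamma(\lambda)}d^{\delta(\lambda)}$. Let $\Phi(a,b,c,d)=\sum_{\lambda} w(\lambda)$, the sum over all integer partitions $\lambda$ (including the empty partition). Then, as formal power series, \[ \Phi(a,b,c,d) = \prod_{j=1}^\infty \frac{(1+a^{j}b^{j-1}c^{j-1}d^{j-1})(1+a^{j}b^{j}c^{j}d^{j-1})} {(1-a^{j}b^{j}c^{j}d^{j})(1-a^{j}b^{j}c^{j-1}d^{j-1}) (1-a^{j}b^{j-1}c^{j}d^{j-1})}. \]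
   Context: Equivalently, $w(\lambda)$ is the product of the entries of the Young diagram of $\lambda$ filled so that odd-numbered rows read $a,b,a,b,\dots$ from left to right and even-numbered rows read $c,d,c,d,\dots$. -}

module Defs where

open import Data.Nat using (ℕ; zero; suc; _+_; _*_; _∸_; _≥_; _<_; ⌊_/2⌋; ⌈_/2⌉)
open import Data.Nat.Properties using (_≟_)
open import Data.Product using (_×_; _,_; Σ)
open import Data.List using (List; []; _∷_)
open import Data.List.Relation.Unary.All using (All)
open import Data.List.Relation.Unary.Linked using (Linked)
open import Relation.Nullary.Decidable using (Dec; yes; no)

record Partition : Set where
  constructor mkPartition
  field
    parts    : List ℕ
    positive : All (0 <_) parts
    decr     : Linked _≥_ parts

open Partition public

-- (α, β, γ, δ) of a list of parts λ₁, λ₂, … :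
--   α = Σ ⌈λ_{odd}/2⌉ , β = Σ ⌊λ_{odd}/2⌋ , γ = Σ ⌈λ_{even}/2⌉ , δ = Σ ⌊λ_{even}/2⌋
-- Recursion: prepending a part x shifts odd/even positions.

exps : List ℕ → ℕ × ℕ × ℕ × ℕ
exps [] = 0 , 0 , 0 , 0
exps (x ∷ xs) with exps xs
... | (α' , β' , γ' , δ') = ⌈ x /2⌉ + γ' , ⌊ x /2⌋ + δ' , α' , β'

weight : Partition → ℕ × ℕ × ℕ × ℕ
weight μ = exps (parts μ)

-- Formal power series in a, b, c, d with ℕ coefficients:
-- S p q r s = coefficient of a^p b^q c^r d^s.

Series : Set
Series = ℕ → ℕ → ℕ → ℕ → ℕ

Mon : Set
Mon = ℕ × ℕ × ℕ × ℕ

sumTo : ℕ → (ℕ → ℕ) → ℕ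
sumTo zero    h = h 0
sumTo (suc n) h = sumTo n h + h (suc n)

_⊛_ : Series → Series → Series
(f ⊛ g) p q r s =
  sumTo p λ i → sumTo q λ j → sumTo r λ k → sumTo s λ l →
    f i j k l * g (p ∸ i) (q ∸ j) (r ∸ k) (s ∸ l)

infixl 7 _⊛_

ind : Mon → Mon → ℕ
ind (a , b , c , d) (a' , b' , c' , d') with a ≟ a' | b ≟ b' | c ≟ c' | d ≟ d'
... | yes _ | yes _ | yes _ | yes _ = 1
... | _     | _     | _     | _     = 0

mono : Mon → Series
mono m p q r s = ind (p , q , r , s) m

one : Series
one = mono (0 , 0 , 0 , 0)

onePlus : Mon → Series
onePlus m p q r s = one p q r s + mono m p q r s

scale : ℕ → Mon → Mon
scale k (a , b , c , d) = k * a , k * b , k * c , k * d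

-- 1/(1 - x^m) = Σ_{k≥0} x^{k m}, for a nonzero exponent vector m.
-- For m ≠ 0 the terms x^{km} are distinct and k m = (p,q,r,s) forces
-- k ≤ p+q+r+s, so the coefficient is the number of such k in that range.
geom : Mon → Series
geom m p q r s = sumTo (p + q + r + s) λ k → ind (p , q , r , s) (scale k m)

factor : ℕ → Series
factor i =
  onePlus (j , i , i , i) ⊛ onePlus (j , j , j , i)
    ⊛ geom (j , j , j , j) ⊛ geom (j , j , i , i) ⊛ geom (j , i , j , i)
  where j = suc i

partialProd : ℕ → Series
partialProd zero    = one
partialProd (suc N) = partialProd N ⊛ factor N

{-# OPTIONS --safe #-}
module Submission where

-- Pair the rows of λ and write λ₂ᵢ₋₁ − λ₂ᵢ = 2 mᵢ + εᵢ with εᵢ ∈ {0 , 1}.  Removing mᵢ pairs of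
-- columns of height 2i − 1 for every i removes mᵢ factors aⁱbⁱcⁱ⁻¹dⁱ⁻¹ and leaves row pairs
-- (x + ε , x).  In the remaining partition the pairs with ε = 0 form an arbitrary multiset of
-- values x ≥ 1, and those with ε = 1 an arbitrary set of values x ≥ 0: among the pairs with
-- the same x the one with ε = 1 comes first.  The weight of (x , x) is that of a geometric
-- factor with a and c in equal powers, the weight of (x + 1 , x) that of a numerator factor.
-- Every pair but (0 , 0) contributes to the power of a, so in a-degree at most N it suffices
-- to consider N pairs of rows, with x ≤ 2N.

open import Defs
open import Data.Nat using (ℕ; zero; suc; _+_; _*_; _∸_; _≤_; _<_; _≥_; z≤n; s≤s; ⌊_/2⌋; ⌈_/2⌉)
open import Data.Nat.Properties
open import Data.Nat.Tactic.RingSolver using (solve-∀)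
open import Data.Bool using (Bool; true; false; if_then_else_)
open import Data.Empty using (⊥-elim)
open import Data.Unit using (⊤; tt)
open import Data.Sum using (_⊎_; inj₁; inj₂)
open import Data.Product using (Σ; ∃; _×_; _,_; proj₁; proj₂)
open import Data.Product.Function.NonDependent.Propositional using (_×-↔_)
open import Data.Sum.Function.Propositional using (_⊎-↔_)
open import Data.Fin using (Fin)
open import Data.Fin.Properties using (+↔⊎; *↔×; 0↔⊥; 1↔⊤)
open import Data.List using (List; []; _∷_; length)
open import Data.List.Relation.Unary.All as All using (All; []; _∷_)
open import Data.List.Relation.Unary.Linked as Linked using (Linked; []; [-]; _∷_)
open import Data.Vec as Vec using (Vec; []; _∷_; _∷ʳ_; init; last; initLast; replicate; sum)
open import Data.Vec.Properties using (init-∷ʳ; last-∷ʳ)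
open import Function.Base using (_∘_)
open import Function.Bundles using (_↔_; mk↔ₛ′)
open import Function.Properties.Inverse using (↔-sym; ↔-trans)
open import Relation.Nullary using (¬_; yes; no)
open import Relation.Binary.PropositionalEquality
  using (_≡_; refl; sym; trans; cong; cong₂; module ≡-Reasoning)

-- Weighted sets

infixl 6 _⊕_

_⊕_ : Mon → Mon → Mon
(a , b , c , d) ⊕ (a' , b' , c' , d') = a + a' , b + b' , c + c' , d + d'

0ₘ : Mon
0ₘ = 0 , 0 , 0 , 0

mon-≡ : ∀ {a b c d a' b' c' d' : ℕ} → a ≡ a' → b ≡ b' → c ≡ c' → d ≡ d' →
        (a , b , c , d) ≡ (a' , b' , c' , d')
mon-≡ refl refl refl refl = refl

⊕-identityʳ : ∀ x → x ⊕ 0ₘ ≡ x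
⊕-identityʳ _ = mon-≡ (+-identityʳ _) (+-identityʳ _) (+-identityʳ _) (+-identityʳ _)

⊕-assoc : ∀ x y z → (x ⊕ y) ⊕ z ≡ x ⊕ (y ⊕ z)
⊕-assoc (a , b , c , d) _ _ = mon-≡ (+-assoc a _ _) (+-assoc b _ _) (+-assoc c _ _) (+-assoc d _ _)

infixl 6 _⊞_

_⊞_ : {A B : Set} → (A → Mon) → (B → Mon) → A × B → Mon
(v ⊞ w) (a , b) = v a ⊕ w b

Fibre : {A : Set} → (A → Mon) → Mon → Set
Fibre w m = Σ _ λ a → w a ≡ m

fibre-≡ : {A : Set} {w : A → Mon} {m : Mon} {x y : Fibre w m} → proj₁ x ≡ proj₁ y → x ≡ y
fibre-≡ {x = _ , refl} {y = _ , refl} refl = refl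

-- B is allowed to be larger than A, but not in a-degree at most N.
infix 4 _⊢_≈_

record _⊢_≈_ (N : ℕ) {A B : Set} (v : A → Mon) (w : B → Mon) : Set where
  field
    into      : A → B
    back      : B → A
    weight-eq : ∀ a → w (into a) ≡ v a
    back-into : ∀ a → back (into a) ≡ a
    into-back : ∀ b → proj₁ (w b) ≤ N → into (back b) ≡ b

module _ {N : ℕ} {A B : Set} {v : A → Mon} {w : B → Mon} (e : N ⊢ v ≈ w) where
  open _⊢_≈_ e

  -- `back` has no weight law of its own: in a-degree at most N its weight is found through
  -- `into (back b) ≡ b`.
  fibre-↔ : ∀ {m} → proj₁ m ≤ N → Fibre v m ↔ Fibre w m
  fibre-↔ {m} m≤N = mk↔ₛ′
    (λ (a , eq) → into a , trans (weight-eq a) eq)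
    (λ (b , eq) → back b ,
       trans (sym (weight-eq (back b))) (trans (cong w (into-back b (small eq))) eq))
    (λ (b , eq) → fibre-≡ (into-back b (small eq)))
    (λ (a , _) → fibre-≡ (back-into a))
    where
    small : ∀ {b} → w b ≡ m → proj₁ (w b) ≤ N
    small refl = m≤N

  ⊞-congʳ : {C : Set} (u : C → Mon) → N ⊢ (u ⊞ v) ≈ (u ⊞ w)
  ⊞-congʳ u = record
    { into      = λ (c , a) → c , into a
    ; back      = λ (c , b) → c , back b
    ; weight-eq = λ (c , a) → cong (u c ⊕_) (weight-eq a)
    ; back-into = λ (c , a) → cong (c ,_) (back-into a)
    ; into-back = λ (c , b) small → cong (c ,_) (into-back b (m+n≤o⇒n≤o (proj₁ (u c)) small))
    }

-- Coefficients as cardinalities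

-- This turns identities of series into bijections: sums of coefficients become disjoint unions,
-- products become pairs.
_Counts_ : {A : Set} → Series → (A → Mon) → Set
S Counts w = ∀ p q r s → Fin (S p q r s) ↔ Fibre w (p , q , r , s)

sumTo-↔ : ∀ n {h : ℕ → ℕ} {B : ℕ → Set} → (∀ i → Fin (h i) ↔ B i) →
          Fin (sumTo n h) ↔ ∃ λ i → i ≤ n × B i
sumTo-↔ zero e = ↔-trans (e 0) (mk↔ₛ′
  (λ b → 0 , z≤n , b)
  (λ { (zero , _ , b) → b })
  (λ { (zero , z≤n , b) → refl })
  (λ _ → refl))
sumTo-↔ (suc n) {B = B} e =
  ↔-trans +↔⊎ (↔-trans (sumTo-↔ n e ⊎-↔ e (suc n)) (mk↔ₛ′ to from to-from from-to))
  where
  to : (∃ λ i → i ≤ n × B i) ⊎ B (suc n) → ∃ λ i → i ≤ suc n × B i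
  to (inj₁ (i , i≤n , b)) = i , m≤n⇒m≤1+n i≤n , b
  to (inj₂ b)             = suc n , ≤-refl , b

  from : (∃ λ i → i ≤ suc n × B i) → (∃ λ i → i ≤ n × B i) ⊎ B (suc n)
  from (i , i≤1+n , b) with m≤n⇒m<n∨m≡n i≤1+n
  ... | inj₁ (s≤s i≤n) = inj₁ (i , i≤n , b)
  ... | inj₂ refl      = inj₂ b

  to-from : ∀ x → to (from x) ≡ x
  to-from (i , i≤1+n , b) with m≤n⇒m<n∨m≡n i≤1+n
  ... | inj₁ (s≤s i≤n) = cong (λ le → i , le , b) (≤-irrelevant _ _)
  ... | inj₂ refl      = cong (λ le → i , le , b) (≤-irrelevant _ _)

  from-to : ∀ x → from (to x) ≡ x
  from-to (inj₁ (i , i≤n , b)) with m≤n⇒m<n∨m≡n (m≤n⇒m≤1+n i≤n)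
  ... | inj₁ (s≤s i≤n') = cong (λ le → inj₁ (i , le , b)) (≤-irrelevant _ _)
  ... | inj₂ refl       = ⊥-elim (1+n≰n i≤n)
  from-to (inj₂ b) with m≤n⇒m<n∨m≡n (≤-refl {suc n})
  ... | inj₁ (s≤s 1+n≤n) = ⊥-elim (1+n≰n 1+n≤n)
  ... | inj₂ refl        = refl

¬⇒Fin0↔ : {A : Set} → ¬ A → Fin 0 ↔ A
¬⇒Fin0↔ ¬a = ↔-trans 0↔⊥ (mk↔ₛ′ ⊥-elim ¬a (λ a → ⊥-elim (¬a a)) λ ())

ind-↔ : ∀ x y → Fin (ind x y) ↔ (y ≡ x)
ind-↔ (a , b , c , d) (a' , b' , c' , d') with a ≟ a' | b ≟ b' | c ≟ c' | d ≟ d'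
... | yes refl | yes refl | yes refl | yes refl =
  ↔-trans 1↔⊤ (mk↔ₛ′ (λ _ → refl) _ (λ { refl → refl }) (λ _ → refl))
... | no ≢  | _     | _     | _    = ¬⇒Fin0↔ λ { refl → ≢ refl }
... | yes _ | no ≢  | _     | _    = ¬⇒Fin0↔ λ { refl → ≢ refl }
... | yes _ | yes _ | no ≢  | _    = ¬⇒Fin0↔ λ { refl → ≢ refl }
... | yes _ | yes _ | yes _ | no ≢ = ¬⇒Fin0↔ λ { refl → ≢ refl }

one-counts : one Counts (λ (_ : ⊤) → 0ₘ)
one-counts p q r s = ↔-trans (ind-↔ _ _) (mk↔ₛ′ (tt ,_) proj₂ (λ _ → refl) (λ _ → refl))

bit : Mon → Bool → Mon
bit m b = if b then m else 0ₘ

onePlus-counts : ∀ m → onePlus m Counts bit m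
onePlus-counts m p q r s = ↔-trans +↔⊎ (↔-trans (ind-↔ _ _ ⊎-↔ ind-↔ _ _) (mk↔ₛ′
  (λ { (inj₁ eq) → false , eq ; (inj₂ eq) → true , eq })
  (λ { (false , eq) → inj₁ eq ; (true , eq) → inj₂ eq })
  (λ { (false , eq) → refl ; (true , eq) → refl })
  (λ { (inj₁ eq) → refl ; (inj₂ eq) → refl })))

-- The exponent of a in the monomial is positive, so `k` is at most `p` and lies within the range of
-- the finite sum that defines `geom`.
geom-counts : ∀ a m → geom (suc a , m) Counts (λ k → scale k (suc a , m))
geom-counts a m p q r s = ↔-trans (sumTo-↔ (p + q + r + s) (λ k → ind-↔ _ _)) (mk↔ₛ′
  (λ (k , _ , eq) → k , eq)
  (λ (k , eq) → k , bound k eq , eq)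
  (λ _ → refl)
  (λ (k , k≤ , eq) → cong (λ le → k , le , eq) (≤-irrelevant _ _)))
  where
  bound : ∀ k → scale k (suc a , m) ≡ (p , q , r , s) → k ≤ p + q + r + s
  bound k eq = ≤-trans (m≤m*n k (suc a)) (≤-trans (≤-reflexive (cong proj₁ eq))
    (≤-trans (m≤m+n p q) (≤-trans (m≤m+n (p + q) r) (m≤m+n (p + q + r) s))))

-- The splitting of the exponent vector is forced: its first half is the weight of the first
-- component and the rest is the difference.
⊛-counts : ∀ {f g} {A B : Set} {v : A → Mon} {w : B → Mon} →
           f Counts v → g Counts w → (f ⊛ g) Counts (v ⊞ w)
⊛-counts {A = A} {B} {v} {w} cf cg p q r s = ↔-trans
  (sumTo-↔ p λ i → sumTo-↔ q λ j → sumTo-↔ r λ k → sumTo-↔ s λ l →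
     ↔-trans *↔× (cf i j k l ×-↔ cg (p ∸ i) (q ∸ j) (r ∸ k) (s ∸ l)))
  (mk↔ₛ′ to from (λ _ → fibre-≡ refl) from-to)
  where
  Splitting : Set
  Splitting = ∃ λ i → i ≤ p × ∃ λ j → j ≤ q × ∃ λ k → k ≤ r × ∃ λ l → l ≤ s ×
    Fibre v (i , j , k , l) × Fibre w (p ∸ i , q ∸ j , r ∸ k , s ∸ l)

  to : Splitting → Fibre (v ⊞ w) (p , q , r , s)
  to (i , i≤p , j , j≤q , k , k≤r , l , l≤s , (a , ea) , (b , eb)) = (a , b) ,
    trans (cong₂ _⊕_ ea eb)
          (mon-≡ (m+[n∸m]≡n i≤p) (m+[n∸m]≡n j≤q) (m+[n∸m]≡n k≤r) (m+[n∸m]≡n l≤s))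

  summand : ∀ {m n o} → m + n ≡ o → m ≤ o
  summand {m} refl = m≤m+n m _

  rest : ∀ {m n o} → m + n ≡ o → n ≡ o ∸ m
  rest {m} {n} refl = sym (m+n∸m≡n m n)

  from : Fibre (v ⊞ w) (p , q , r , s) → Splitting
  from ((a , b) , eq) =
    _ , summand e₁ , _ , summand e₂ , _ , summand e₃ , _ , summand e₄ ,
    (a , refl) , (b , mon-≡ (rest e₁) (rest e₂) (rest e₃) (rest e₄))
    where
    e₁ = cong proj₁ eq
    e₂ = cong (proj₁ ∘ proj₂) eq
    e₃ = cong (proj₁ ∘ proj₂ ∘ proj₂) eq
    e₄ = cong (proj₂ ∘ proj₂ ∘ proj₂) eq

  splitting-≡ : ∀ {i j k l} {i≤p i≤p' : i ≤ p} {j≤q j≤q' : j ≤ q} {k≤r k≤r' : k ≤ r}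
                {l≤s l≤s' : l ≤ s} {x : Fibre v (i , j , k , l)}
                {y y' : Fibre w (p ∸ i , q ∸ j , r ∸ k , s ∸ l)} → proj₁ y ≡ proj₁ y' →
                _≡_ {A = Splitting} (i , i≤p , j , j≤q , k , k≤r , l , l≤s , x , y)
                                    (i , i≤p' , j , j≤q' , k , k≤r' , l , l≤s' , x , y')
  splitting-≡ {i≤p = i≤p} {i≤p'} {j≤q} {j≤q'} {k≤r} {k≤r'} {l≤s} {l≤s'} {y = y} {y'} eq
    with ≤-irrelevant i≤p i≤p' | ≤-irrelevant j≤q j≤q' | ≤-irrelevant k≤r k≤r'
       | ≤-irrelevant l≤s l≤s' | fibre-≡ {x = y} {y'} eq
  ... | refl | refl | refl | refl | refl = refl

  from-to : ∀ x → from (to x) ≡ x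
  -- Matching on `refl` identifies the indices with the weight of the first element, which leaves
  -- only proofs to compare.
  from-to (_ , _ , _ , _ , _ , _ , _ , _ , (_ , refl) , _) = splitting-≡ refl

-- Terms of the expanded product

factorWeight : ℕ → (((Bool × Bool) × ℕ) × ℕ) × ℕ → Mon
factorWeight i =
  bit (j , i , i , i) ⊞ bit (j , j , j , i)
    ⊞ (λ k → scale k (j , j , j , j)) ⊞ (λ k → scale k (j , j , i , i)) ⊞ (λ k → scale k (j , i , j , i))
  where j = suc i

factor-counts : ∀ i → factor i Counts factorWeight i
factor-counts i =
  ⊛-counts (⊛-counts (⊛-counts (⊛-counts (onePlus-counts _) (onePlus-counts _))
    (geom-counts i _)) (geom-counts i _)) (geom-counts i _)

Choices : ℕ → Set
Choices zero    = ⊤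
Choices (suc N) = Choices N × (((Bool × Bool) × ℕ) × ℕ) × ℕ

choicesWeight : ∀ N → Choices N → Mon
choicesWeight zero    = λ _ → 0ₘ
choicesWeight (suc N) = choicesWeight N ⊞ factorWeight N

partialProd-counts : ∀ N → partialProd N Counts choicesWeight N
partialProd-counts zero    = one-counts
partialProd-counts (suc N) = ⊛-counts (partialProd-counts N) (factor-counts N)

-- Doubling and halving

double : ℕ → ℕ
double zero    = zero
double (suc n) = suc (suc (double n))

double-+ : ∀ m n → double (m + n) ≡ double m + double n
double-+ zero    n = refl
double-+ (suc m) n = cong (suc ∘ suc) (double-+ m n)

double-mono : ∀ {m n} → m ≤ n → double m ≤ double n
double-mono z≤n     = z≤n
double-mono (s≤s p) = s≤s (s≤s (double-mono p))

⌊double+/2⌋ : ∀ m n → ⌊ double m + n /2⌋ ≡ m + ⌊ n /2⌋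
⌊double+/2⌋ zero    n = refl
⌊double+/2⌋ (suc m) n = cong suc (⌊double+/2⌋ m n)

⌈double+/2⌉ : ∀ m n → ⌈ double m + n /2⌉ ≡ m + ⌈ n /2⌉
-- `⌈ n /2⌉` unfolds to `⌊ suc n /2⌋`, which reduces the claim to the one for floors.
⌈double+/2⌉ m n = trans (cong ⌊_/2⌋ (sym (+-suc (double m) n))) (⌊double+/2⌋ m (suc n))

⌊double/2⌋ : ∀ n → ⌊ double n /2⌋ ≡ n
⌊double/2⌋ zero    = refl
⌊double/2⌋ (suc n) = cong suc (⌊double/2⌋ n)

⌈double/2⌉ : ∀ n → ⌈ double n /2⌉ ≡ n
⌈double/2⌉ zero    = refl
⌈double/2⌉ (suc n) = cong suc (⌈double/2⌉ n)

n≤double⌈n/2⌉ : ∀ n → n ≤ double ⌈ n /2⌉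
n≤double⌈n/2⌉ zero          = z≤n
n≤double⌈n/2⌉ (suc zero)    = s≤s z≤n
n≤double⌈n/2⌉ (suc (suc n)) = s≤s (s≤s (n≤double⌈n/2⌉ n))

-- Pairs of rows

rowPair : ℕ → ℕ → Mon
rowPair x y = ⌈ x /2⌉ , ⌊ x /2⌋ , ⌈ y /2⌉ , ⌊ y /2⌋

-- (h , g) ∷ v adds, on top of the row pairs v, a row exceeding the largest of them by h
-- and above it a row longer by g.
Gaps : ℕ → Set
Gaps = Vec (ℕ × ℕ)

height : ∀ {n} → Gaps n → ℕ
height []            = 0
height ((h , g) ∷ v) = g + (h + height v)

gapsWeight : ∀ {n} → Gaps n → Mon
gapsWeight []            = 0ₘ
gapsWeight ((h , g) ∷ v) = rowPair (g + (h + height v)) (h + height v) ⊕ gapsWeight v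

-- The longest row x alone contributes `⌈ x /2⌉` to the exponent of a.
height≤double : ∀ {n} (v : Gaps n) → height v ≤ double (proj₁ (gapsWeight v))
height≤double []            = z≤n
height≤double ((h , g) ∷ v) = ≤-trans (n≤double⌈n/2⌉ _) (double-mono (m≤m+n _ _))

-- Partitions as gap vectors

hd : List ℕ → ℕ
hd []      = 0
hd (x ∷ _) = x

tl : List ℕ → List ℕ
tl []       = []
tl (_ ∷ xs) = xs

-- Zero rows of a gap vector are not parts. Dropping the tail along with a zero is harmless, as in a
-- decreasing sequence only zeros can follow.
cons⁺ : ℕ → List ℕ → List ℕ
cons⁺ zero    _  = []
cons⁺ (suc x) xs = suc x ∷ xs

hd-cons⁺ : ∀ x xs → hd (cons⁺ x xs) ≡ x
hd-cons⁺ zero    xs = refl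
hd-cons⁺ (suc x) xs = refl

tl-cons⁺ : ∀ x xs → (x ≡ 0 → xs ≡ []) → tl (cons⁺ x xs) ≡ xs
tl-cons⁺ zero    xs z = sym (z refl)
tl-cons⁺ (suc x) xs z = refl

exps-cons⁺ : ∀ x xs → (x ≡ 0 → xs ≡ []) → exps (cons⁺ x xs) ≡ exps (x ∷ xs)
exps-cons⁺ zero    xs z rewrite z refl = refl
exps-cons⁺ (suc x) xs z = refl

cons⁺-hd-tl : ∀ {xs} → All (0 <_) xs → cons⁺ (hd xs) (tl xs) ≡ xs
cons⁺-hd-tl []                = refl
cons⁺-hd-tl {suc x ∷ xs} (_ ∷ _) = refl

tl-positive : ∀ {xs} → All (0 <_) xs → All (0 <_) (tl xs)
tl-positive []       = []
tl-positive (_ ∷ ps) = ps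

tl-decr : ∀ {xs} → Linked _≥_ xs → Linked _≥_ (tl xs)
tl-decr []       = []
tl-decr [-]      = []
tl-decr (_ ∷ ps) = ps

hd-tl≤hd : ∀ {xs} → Linked _≥_ xs → hd (tl xs) ≤ hd xs
hd-tl≤hd []      = z≤n
hd-tl≤hd [-]     = z≤n
hd-tl≤hd (p ∷ _) = p

cons⁺-positive : ∀ x {xs} → All (0 <_) xs → All (0 <_) (cons⁺ x xs)
cons⁺-positive zero    ps = []
cons⁺-positive (suc x) ps = s≤s z≤n ∷ ps

cons⁺-decr : ∀ x {xs} → hd xs ≤ x → Linked _≥_ xs → Linked _≥_ (cons⁺ x xs)
cons⁺-decr zero    _ _                = []
cons⁺-decr (suc x) {[]}     _ _       = [-]
cons⁺-decr (suc x) {_ ∷ _} le ps      = le ∷ ps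

toParts : ∀ {n} → Gaps n → List ℕ
toParts []            = []
toParts ((h , g) ∷ v) = cons⁺ (g + (h + height v)) (cons⁺ (h + height v) (toParts v))

-- Missing parts are read as 0, and parts beyond the first 2n are cut off; hence the length bounds
-- below.
fromParts : ∀ n → List ℕ → Gaps n
fromParts zero    xs = []
fromParts (suc n) xs =
  (hd (tl xs) ∸ hd (tl (tl xs)) , hd xs ∸ hd (tl xs)) ∷ fromParts n (tl (tl xs))

hd-toParts : ∀ {n} (v : Gaps n) → hd (toParts v) ≡ height v
hd-toParts []      = refl
hd-toParts (_ ∷ v) = hd-cons⁺ _ _

toParts≡[] : ∀ {n} (v : Gaps n) → height v ≡ 0 → toParts v ≡ []
toParts≡[] []            eq = refl
toParts≡[] ((h , g) ∷ v) eq rewrite eq = refl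

private
  lower≡[] : ∀ {n} h (v : Gaps n) → h + height v ≡ 0 → toParts v ≡ []
  lower≡[] h v eq = toParts≡[] v (m+n≡0⇒n≡0 h eq)

  upper≡[] : ∀ {n} g h (v : Gaps n) → g + (h + height v) ≡ 0 →
             cons⁺ (h + height v) (toParts v) ≡ []
  upper≡[] g h v eq rewrite m+n≡0⇒n≡0 g eq = refl

toParts-positive : ∀ {n} (v : Gaps n) → All (0 <_) (toParts v)
toParts-positive []            = []
toParts-positive ((h , g) ∷ v) = cons⁺-positive _ (cons⁺-positive _ (toParts-positive v))

toParts-decr : ∀ {n} (v : Gaps n) → Linked _≥_ (toParts v)
toParts-decr []            = []
toParts-decr ((h , g) ∷ v) = cons⁺-decr _
  (≤-trans (≤-reflexive (hd-cons⁺ _ (toParts v))) (m≤n+m _ g))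
  (cons⁺-decr _ (≤-trans (≤-reflexive (hd-toParts v)) (m≤n+m _ h)) (toParts-decr v))

exps-toParts : ∀ {n} (v : Gaps n) → exps (toParts v) ≡ gapsWeight v
exps-toParts []            = refl
exps-toParts ((h , g) ∷ v) = begin
  exps (cons⁺ x (cons⁺ y (toParts v)))  ≡⟨ exps-cons⁺ x _ (upper≡[] g h v) ⟩
  exps (x ∷ cons⁺ y (toParts v))
    ≡⟨ cong (λ (α , β , γ , δ) → ⌈ x /2⌉ + γ , ⌊ x /2⌋ + δ , α , β)
            (exps-cons⁺ y (toParts v) (lower≡[] h v)) ⟩
  rowPair x y ⊕ exps (toParts v)        ≡⟨ cong (rowPair x y ⊕_) (exps-toParts v) ⟩
  rowPair x y ⊕ gapsWeight v            ∎
  where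
  open ≡-Reasoning
  y = h + height v
  x = g + y

fromParts-toParts : ∀ {n} (v : Gaps n) → fromParts n (toParts v) ≡ v
fromParts-toParts []            = refl
fromParts-toParts ((h , g) ∷ v)
  rewrite tl-cons⁺ (g + (h + height v)) (cons⁺ (h + height v) (toParts v)) (upper≡[] g h v)
        | hd-cons⁺ (g + (h + height v)) (cons⁺ (h + height v) (toParts v))
        | tl-cons⁺ (h + height v) (toParts v) (lower≡[] h v)
        | hd-cons⁺ (h + height v) (toParts v)
        | hd-toParts v
        | m+n∸n≡m g (h + height v)
        | m+n∸n≡m h (height v)
        | fromParts-toParts v = refl

tl²-length : ∀ {n} xs → length xs ≤ double (suc n) → length (tl (tl xs)) ≤ double n
tl²-length []           _               = z≤n
tl²-length (_ ∷ [])     _               = z≤n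
tl²-length (_ ∷ _ ∷ xs) (s≤s (s≤s le))  = le

-- The differences telescope; each truncated subtraction is exact because the parts decrease.
height-fromParts : ∀ n {xs} → Linked _≥_ xs → length xs ≤ double n → height (fromParts n xs) ≡ hd xs
height-fromParts zero    {[]} ps _  = refl
height-fromParts (suc n) {xs} ps le
  rewrite height-fromParts n (tl-decr (tl-decr ps)) (tl²-length xs le)
        | m∸n+n≡m (hd-tl≤hd (tl-decr ps))
        | m∸n+n≡m (hd-tl≤hd ps) = refl

toParts-fromParts : ∀ n {xs} → All (0 <_) xs → Linked _≥_ xs → length xs ≤ double n →
                    toParts (fromParts n xs) ≡ xs
toParts-fromParts zero    {[]} _ _ _ = refl
toParts-fromParts (suc n) {xs} pos ps le
  rewrite height-fromParts n (tl-decr (tl-decr ps)) (tl²-length xs le)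
        | m∸n+n≡m (hd-tl≤hd (tl-decr ps))
        | m∸n+n≡m (hd-tl≤hd ps)
        | toParts-fromParts n (tl-positive (tl-positive pos)) (tl-decr (tl-decr ps)) (tl²-length xs le)
        | cons⁺-hd-tl (tl-positive pos) = cons⁺-hd-tl pos

-- Every part in an odd position is positive and so adds at least 1 to the exponent of a.
length≤double-exps : ∀ {xs} → All (0 <_) xs → length xs ≤ double (proj₁ (exps xs))
length≤double-exps []              = z≤n
length≤double-exps (s≤s _ ∷ [])    = s≤s z≤n
length≤double-exps (s≤s {n = x} _ ∷ _ ∷ pos) =
  s≤s (s≤s (≤-trans (length≤double-exps pos) (double-mono (m≤n+m _ ⌊ x /2⌋))))

partition-≡ : ∀ {μ ν : Partition} → parts μ ≡ parts ν → μ ≡ ν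
partition-≡ {mkPartition xs p q} {mkPartition xs p' q'} refl =
  cong₂ (mkPartition xs) (All.irrelevant ≤-irrelevant p p') (Linked.irrelevant ≤-irrelevant q q')

gaps≈partitions : ∀ N → N ⊢ gapsWeight {N} ≈ weight
gaps≈partitions N = record
  { into      = λ v → mkPartition (toParts v) (toParts-positive v) (toParts-decr v)
  ; back      = λ μ → fromParts N (parts μ)
  ; weight-eq = exps-toParts
  ; back-into = fromParts-toParts
  ; into-back = λ μ small → partition-≡ (toParts-fromParts N (positive μ) (decr μ)
      (≤-trans (length≤double-exps (positive μ)) (double-mono small)))
  }

-- Columns of odd height

𝟙 : Bool → ℕ
𝟙 b = if b then 1 else 0

odd : ℕ → Bool
odd zero          = false
odd (suc zero)    = true
odd (suc (suc n)) = odd n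

double⌊n/2⌋+odd : ∀ n → double ⌊ n /2⌋ + 𝟙 (odd n) ≡ n
double⌊n/2⌋+odd zero          = refl
double⌊n/2⌋+odd (suc zero)    = refl
double⌊n/2⌋+odd (suc (suc n)) = cong (suc ∘ suc) (double⌊n/2⌋+odd n)

⌊double+𝟙/2⌋ : ∀ m b → ⌊ double m + 𝟙 b /2⌋ ≡ m
⌊double+𝟙/2⌋ zero    false = refl
⌊double+𝟙/2⌋ zero    true  = refl
⌊double+𝟙/2⌋ (suc m) b     = cong suc (⌊double+𝟙/2⌋ m b)

odd-double+𝟙 : ∀ m b → odd (double m + 𝟙 b) ≡ b
odd-double+𝟙 zero    false = refl
odd-double+𝟙 zero    true  = refl
odd-double+𝟙 (suc m) b     = odd-double+𝟙 m b

-- Gap vectors whose pairs have the form (x + ε , x), with ε kept as a Boolean.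
Steps : ℕ → Set
Steps = Vec (ℕ × Bool)

stepGaps : ∀ {n} → Steps n → Gaps n
stepGaps = Vec.map λ (h , b) → h , 𝟙 b

-- The m at position i (from 0) stands for m pairs of columns of height 2i + 1.
columnsWeight : ∀ {n} → ℕ → Vec ℕ n → Mon
columnsWeight i []      = 0ₘ
columnsWeight i (m ∷ M) = scale m (suc i , suc i , i , i) ⊕ columnsWeight (suc i) M

-- Two more rows on a pair of columns contribute one further factor abcd.
columnsWeight-suc : ∀ {n} i (M : Vec ℕ n) →
  columnsWeight (suc i) M ≡ (sum M , sum M , sum M , sum M) ⊕ columnsWeight i M
columnsWeight-suc i []      = refl
columnsWeight-suc i (m ∷ M) rewrite columnsWeight-suc (suc i) M =
  mon-≡ (eq m (suc i) _ _) (eq m (suc i) _ _) (eq m i _ _) (eq m i _ _)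
  where
  eq : ∀ m i S x → m * suc i + (S + x) ≡ m + S + (m * i + x)
  eq = solve-∀

-- The recursion peels off the shortest columns, whereas a new factor of the product brings in the
-- tallest.
columnsWeight-∷ʳ : ∀ {n} i (M : Vec ℕ n) m →
  columnsWeight i (M ∷ʳ m) ≡ columnsWeight i M ⊕ scale m (suc (i + n) , suc (i + n) , i + n , i + n)
columnsWeight-∷ʳ i [] m rewrite +-identityʳ i = ⊕-identityʳ _
columnsWeight-∷ʳ {suc n} i (k ∷ M) m
  rewrite columnsWeight-∷ʳ (suc i) M m | +-suc i n = sym (⊕-assoc (scale k _) _ _)

-- Enlarging the gap inside the pair at position i by 2m lengthens the first 2i + 1 rows, which
-- inserts m pairs of columns of that height.
widen : ∀ {n} → Vec ℕ n → Steps n → Gaps n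
widen []      []            = []
widen (m ∷ M) ((h , b) ∷ v) = (h , double m + 𝟙 b) ∷ widen M v

narrow : ∀ {n} → Gaps n → Vec ℕ n × Steps n
narrow []            = [] , []
narrow ((h , g) ∷ v) = ⌊ g /2⌋ ∷ proj₁ (narrow v) , (h , odd g) ∷ proj₂ (narrow v)

narrow-widen : ∀ {n} (M : Vec ℕ n) v → narrow (widen M v) ≡ (M , v)
narrow-widen []      []            = refl
narrow-widen (m ∷ M) ((h , b) ∷ v)
  rewrite narrow-widen M v | ⌊double+𝟙/2⌋ m b | odd-double+𝟙 m b = refl

widen-narrow : ∀ {n} (v : Gaps n) → widen (proj₁ (narrow v)) (proj₂ (narrow v)) ≡ v
widen-narrow []            = refl
widen-narrow ((h , g) ∷ v) = cong₂ (λ g v → (h , g) ∷ v) (double⌊n/2⌋+odd g) (widen-narrow v)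

-- All inserted columns meet the first row.
height-widen : ∀ {n} (M : Vec ℕ n) v → height (widen M v) ≡ double (sum M) + height (stepGaps v)
height-widen []      []            = refl
height-widen (m ∷ M) ((h , b) ∷ v)
  rewrite height-widen M v | double-+ m (sum M) = eq (double m) (double (sum M)) h (𝟙 b) _
  where
  eq : ∀ m S h b x → m + b + (h + (S + x)) ≡ m + S + (b + (h + x))
  eq = solve-∀

-- Inserting an even number of cells keeps the alternation of labels along a row.
rowPair-double : ∀ s t x y → rowPair (double s + x) (double t + y) ≡ (s , s , t , t) ⊕ rowPair x y
rowPair-double s t x y =
  mon-≡ (⌈double+/2⌉ s x) (⌊double+/2⌋ s x) (⌈double+/2⌉ t y) (⌊double+/2⌋ t y)

-- In the top pair the upper row grows by 2(m + S) and the lower by 2S: m factors ab from the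
-- columns of height 1, and S factors abcd that lift the columns of the pairs below by two rows.
gapsWeight-widen : ∀ {n} (M : Vec ℕ n) v →
  gapsWeight (widen M v) ≡ columnsWeight 0 M ⊕ gapsWeight (stepGaps v)
gapsWeight-widen []      []            = refl
gapsWeight-widen (m ∷ M) ((h , b) ∷ v) = begin
  rowPair (height (widen (m ∷ M) ((h , b) ∷ v))) (h + height (widen M v)) ⊕ gapsWeight (widen M v)
    ≡⟨ cong₂ (λ x y → rowPair x y ⊕ gapsWeight (widen M v))
         (height-widen (m ∷ M) ((h , b) ∷ v))
         (trans (cong (h +_) (height-widen M v)) (swap h (double S) _)) ⟩
  rowPair (double (m + S) + x) (double S + y) ⊕ gapsWeight (widen M v)
    ≡⟨ cong₂ _⊕_ (rowPair-double (m + S) S x y) (gapsWeight-widen M v) ⟩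
  (m + S , m + S , S , S) ⊕ rowPair x y ⊕ (columnsWeight 0 M ⊕ gapsWeight (stepGaps v))
    ≡⟨ mon-≡ (eq₁ m S _ _ _) (eq₁ m S _ _ _) (eq₀ m S _ _ _) (eq₀ m S _ _ _) ⟩
  scale m (1 , 1 , 0 , 0) ⊕ ((S , S , S , S) ⊕ columnsWeight 0 M)
    ⊕ (rowPair x y ⊕ gapsWeight (stepGaps v))
    ≡⟨ cong (λ c → scale m (1 , 1 , 0 , 0) ⊕ c ⊕ (rowPair x y ⊕ gapsWeight (stepGaps v)))
         (columnsWeight-suc 0 M) ⟨
  columnsWeight 0 (m ∷ M) ⊕ gapsWeight (stepGaps ((h , b) ∷ v)) ∎
  where
  open ≡-Reasoning
  S = sum M
  y = h + height (stepGaps v)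
  x = 𝟙 b + y

  swap : ∀ h S z → h + (S + z) ≡ S + (h + z)
  swap = solve-∀

  eq₁ : ∀ m S x c g → m + S + x + (c + g) ≡ m * 1 + (S + c) + (x + g)
  eq₁ = solve-∀

  eq₀ : ∀ m S x c g → S + x + (c + g) ≡ m * 0 + (S + c) + (x + g)
  eq₀ = solve-∀

columns×steps≈gaps : ∀ N n → N ⊢ columnsWeight {n} 0 ⊞ (gapsWeight ∘ stepGaps {n}) ≈ gapsWeight {n}
columns×steps≈gaps N n = record
  { into      = λ (M , v) → widen M v
  ; back      = narrow
  ; weight-eq = λ (M , v) → gapsWeight-widen M v
  ; back-into = λ (M , v) → narrow-widen M v
  ; into-back = λ v _ → widen-narrow v
  }

-- Delannoy paths

-- The row pairs (x + ε , x), together with the units by which x grows between them, form a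
-- path: flat is a row pair (x , x), diag a row pair (x + 1 , x), up a change of x by 1.
-- A path ends with its lowest rows, so x is the number of levels that remain.
data Path : ℕ → ℕ → Set where
  ups   : ∀ {K} → Path 0 K
  flats : ∀ {n} → Path (suc n) 0
  flat  : ∀ {n K} → Path n (suc K) → Path (suc n) (suc K)
  up    : ∀ {n K} → Path (suc n) K → Path (suc n) (suc K)
  diag  : ∀ {n K} → Path n K → Path (suc n) (suc K)

pathWeight : ∀ {n K} → Path n K → Mon
pathWeight ups              = 0ₘ
pathWeight flats            = 0ₘ
pathWeight (flat {K = K} p) = rowPair (suc K) (suc K) ⊕ pathWeight p
pathWeight (up p)           = pathWeight p
pathWeight (diag {K = K} p) = rowPair (suc K) K ⊕ pathWeight p

-- The first component counts the initial `up` steps. It becomes the gap `h` of the pair just above,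
-- or the slack above the whole diagram. In the boundary cases, `ups` has no pairs left and `flats`
-- has only pairs (0 , 0).
rows : ∀ {n K} → Path n K → ℕ × Steps n
rows (ups {K})   = K , []
rows (flats {n}) = 0 , replicate (suc n) (0 , false)
rows (flat p)    = 0 , (proj₁ (rows p) , false) ∷ proj₂ (rows p)
rows (up p)      = suc (proj₁ (rows p)) , proj₂ (rows p)
rows (diag p)    = 0 , (proj₁ (rows p) , true) ∷ proj₂ (rows p)

-- Meant for `t + height (stepGaps v) ≡ K`; otherwise the first two clauses discard data.
fromRows : ∀ {n} K → ℕ → Steps n → Path n K
fromRows K       t       []                = ups
fromRows zero    t       (_ ∷ _)           = flats
fromRows (suc K) (suc t) (x ∷ v)           = up (fromRows K t (x ∷ v))
fromRows (suc K) zero    ((h , false) ∷ v) = flat (fromRows (suc K) h v)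
fromRows (suc K) zero    ((h , true) ∷ v)  = diag (fromRows K h v)

height-zeros : ∀ n → height (stepGaps (replicate n (0 , false))) ≡ 0
height-zeros zero    = refl
height-zeros (suc n) = height-zeros n

-- An `up` or `diag` step uses one level, as part of a gap or as ε; a `flat` step uses none.
rows-height : ∀ {n K} (p : Path n K) → proj₁ (rows p) + height (stepGaps (proj₂ (rows p))) ≡ K
rows-height ups         = +-identityʳ _
rows-height (flats {n}) = height-zeros n
rows-height (flat p)    = rows-height p
rows-height (up p)      = cong suc (rows-height p)
rows-height (diag p)    = cong suc (rows-height p)

gapsWeight-zeros : ∀ n → gapsWeight (stepGaps (replicate n (0 , false))) ≡ 0ₘ
gapsWeight-zeros zero    = refl
gapsWeight-zeros (suc n) rewrite height-zeros n | gapsWeight-zeros n = refl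

gapsWeight-rows : ∀ {n K} (p : Path n K) → gapsWeight (stepGaps (proj₂ (rows p))) ≡ pathWeight p
gapsWeight-rows ups         = refl
gapsWeight-rows (flats {n}) = gapsWeight-zeros (suc n)
gapsWeight-rows (flat p) rewrite rows-height p | gapsWeight-rows p = refl
gapsWeight-rows (up p)      = gapsWeight-rows p
gapsWeight-rows (diag p) rewrite rows-height p | gapsWeight-rows p = refl

fromRows-rows : ∀ {n K} (p : Path n K) → fromRows K (proj₁ (rows p)) (proj₂ (rows p)) ≡ p
fromRows-rows ups      = refl
fromRows-rows flats    = refl
fromRows-rows (flat p) = cong flat (fromRows-rows p)
fromRows-rows (up {n} p) with rows p | fromRows-rows p
... | t , x ∷ v | eq = cong up eq
fromRows-rows (diag p) = cong diag (fromRows-rows p)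

height≡0⇒zeros : ∀ {n} (v : Steps n) → height (stepGaps v) ≡ 0 → v ≡ replicate n (0 , false)
height≡0⇒zeros []                   eq = refl
height≡0⇒zeros ((zero , false) ∷ v) eq = cong (_ ∷_) (height≡0⇒zeros v eq)

rows-fromRows : ∀ {n} K t (v : Steps n) → t + height (stepGaps v) ≡ K → rows (fromRows K t v) ≡ (t , v)
rows-fromRows K       t       []                eq = cong (_, []) (trans (sym eq) (+-identityʳ t))
rows-fromRows zero    zero    (x ∷ v)           eq = cong (0 ,_) (sym (height≡0⇒zeros (x ∷ v) eq))
rows-fromRows (suc K) (suc t) (x ∷ v)           eq
  rewrite rows-fromRows K t (x ∷ v) (suc-injective eq) = refl
rows-fromRows (suc K) zero    ((h , false) ∷ v) eq
  rewrite rows-fromRows (suc K) h v eq = refl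
rows-fromRows (suc K) zero    ((h , true) ∷ v)  eq
  rewrite rows-fromRows K h v (suc-injective eq) = refl

paths≈steps : ∀ N n → N ⊢ pathWeight {n} {double N} ≈ gapsWeight ∘ stepGaps {n}
paths≈steps N n = record
  { into      = proj₂ ∘ rows
  ; back      = back
  ; weight-eq = gapsWeight-rows
  ; back-into = λ p → trans (cong (λ t → fromRows (double N) t (proj₂ (rows p))) (top p)) (fromRows-rows p)
  ; into-back = λ v small → cong proj₂ (rows-fromRows (double N) _ v
      (m∸n+n≡m (≤-trans (height≤double (stepGaps v)) (double-mono small))))
  }
  where
  back : Steps n → Path n (double N)
  -- The levels above the first pair are filled with `up` steps.
  back v = fromRows (double N) (double N ∸ height (stepGaps v)) v

  top : ∀ (p : Path n (double N)) →
        double N ∸ height (stepGaps (proj₂ (rows p))) ≡ proj₁ (rows p)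
  top p = trans (cong (_∸ H) (sym (rows-height p))) (m+n∸n≡m (proj₁ (rows p)) H)
    where H = height (stepGaps (proj₂ (rows p)))

-- (k , b) at level suc K: k flat steps at x = suc K, then a step down to x = K, diagonal if b.
Levels : ℕ → Set
Levels = Vec (ℕ × Bool)

levelsWeight : ∀ {K} → Levels K → Mon
levelsWeight []                    = 0ₘ
levelsWeight {suc K} ((k , b) ∷ u) =
  scale k (rowPair (suc K) (suc K)) ⊕ (bit (rowPair (suc K) K) b ⊕ levelsWeight u)

addFlat : ∀ {K} → Levels (suc K) → Levels (suc K)
addFlat ((k , b) ∷ u) = (suc k , b) ∷ u

-- The same path is read level by level instead of pair by pair, so pairs (0 , 0) leave no trace.
levels : ∀ {n K} → Path n K → Levels K
levels (ups {K}) = replicate K (0 , false)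
levels flats     = []
levels (flat p)  = addFlat (levels p)
levels (up p)    = (0 , false) ∷ levels p
levels (diag p)  = (0 , true) ∷ levels p

fromLevels : ∀ n {K} → Levels K → Path n K
fromLevels zero    u                   = ups
fromLevels (suc n) []                  = flats
fromLevels (suc n) ((suc k , b) ∷ u)   = flat (fromLevels n ((k , b) ∷ u))
fromLevels (suc n) ((zero , false) ∷ u) = up (fromLevels (suc n) u)
fromLevels (suc n) ((zero , true) ∷ u)  = diag (fromLevels n u)

fromLevels-levels : ∀ {n K} (p : Path n K) → fromLevels n (levels p) ≡ p
fromLevels-levels ups      = refl
fromLevels-levels flats    = refl
fromLevels-levels (flat p) with levels p | fromLevels-levels p
... | (k , b) ∷ u | eq = cong flat eq
fromLevels-levels (up p)   = cong up (fromLevels-levels p)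
fromLevels-levels (diag p) = cong diag (fromLevels-levels p)

levelsWeight-zeros : ∀ K → levelsWeight (replicate K (0 , false)) ≡ 0ₘ
levelsWeight-zeros zero    = refl
levelsWeight-zeros (suc K) = levelsWeight-zeros K

levelsWeight-addFlat : ∀ {K} (u : Levels (suc K)) →
  levelsWeight (addFlat u) ≡ rowPair (suc K) (suc K) ⊕ levelsWeight u
levelsWeight-addFlat {K} ((k , b) ∷ u) =
  ⊕-assoc (rowPair (suc K) (suc K)) (scale k (rowPair (suc K) (suc K)))
    (bit (rowPair (suc K) K) b ⊕ levelsWeight u)

levelsWeight-levels : ∀ {n K} (p : Path n K) → levelsWeight (levels p) ≡ pathWeight p
levelsWeight-levels (ups {K}) = levelsWeight-zeros K
levelsWeight-levels flats     = refl
levelsWeight-levels (flat p)  =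
  trans (levelsWeight-addFlat (levels p)) (cong (rowPair _ _ ⊕_) (levelsWeight-levels p))
levelsWeight-levels (up p)    = levelsWeight-levels p
levelsWeight-levels (diag p)  = cong (rowPair _ _ ⊕_) (levelsWeight-levels p)

-- This is the number of row pairs other than (0 , 0); each of them adds at least 1 to the exponent
-- of a.
marks : ∀ {K} → Levels K → ℕ
marks []            = 0
marks ((k , b) ∷ u) = k + (𝟙 b + marks u)

marks≤weight : ∀ {K} (u : Levels K) → marks u ≤ proj₁ (levelsWeight u)
marks≤weight []                    = z≤n
marks≤weight {suc K} ((k , b) ∷ u) =
  +-mono-≤ (m≤m*n k ⌈ suc K /2⌉) (+-mono-≤ (bit≥𝟙 b) (marks≤weight u))
  where
  bit≥𝟙 : ∀ b → 𝟙 b ≤ proj₁ (bit (rowPair (suc K) K) b)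
  bit≥𝟙 false = z≤n
  bit≥𝟙 true  = s≤s z≤n

marks≡0⇒zeros : ∀ {K} (u : Levels K) → marks u ≤ 0 → u ≡ replicate K (0 , false)
marks≡0⇒zeros []                   le = refl
marks≡0⇒zeros ((zero , false) ∷ u) le = cong (_ ∷_) (marks≡0⇒zeros u le)

-- With `n` pairs available every mark finds its pair, and the surplus pairs end up as (0 , 0) in
-- `flats`; with too few, `ups` would cut off marks.
levels-fromLevels : ∀ n {K} (u : Levels K) → marks u ≤ n → levels (fromLevels n u) ≡ u
levels-fromLevels zero    u                    le       = sym (marks≡0⇒zeros u le)
levels-fromLevels (suc n) []                   le       = refl
levels-fromLevels (suc n) ((suc k , b) ∷ u)    (s≤s le) =
  cong addFlat (levels-fromLevels n ((k , b) ∷ u) le)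
levels-fromLevels (suc n) ((zero , false) ∷ u) le       = cong (_ ∷_) (levels-fromLevels (suc n) u le)
levels-fromLevels (suc n) ((zero , true) ∷ u)  (s≤s le) = cong (_ ∷_) (levels-fromLevels n u le)

paths≈levels : ∀ N K → N ⊢ pathWeight {N} {K} ≈ levelsWeight {K}
paths≈levels N K = record
  { into      = levels
  ; back      = fromLevels N
  ; weight-eq = levelsWeight-levels
  ; back-into = fromLevels-levels
  ; into-back = λ u small → levels-fromLevels N u (≤-trans (marks≤weight u) small)
  }

-- The factors of the product

-- Factor N supplies the two levels 2N + 2 (`k₂`, `b₁`) and 2N + 1 (`k₁`, `b₀`), together with `m`
-- pairs of columns of height 2N + 1.
choices : ∀ N → Choices N → Vec ℕ N × Levels (double N)
choices zero    _ = [] , []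
choices (suc N) (x , (((b₀ , b₁) , k₂) , m) , k₁) =
  proj₁ (choices N x) ∷ʳ m , (k₂ , b₁) ∷ (k₁ , b₀) ∷ proj₂ (choices N x)

fromChoices : ∀ N → Vec ℕ N × Levels (double N) → Choices N
fromChoices zero    _ = tt
fromChoices (suc N) (M , (k₂ , b₁) ∷ (k₁ , b₀) ∷ u) =
  fromChoices N (init M , u) , (((b₀ , b₁) , k₂) , last M) , k₁

fromChoices-choices : ∀ N x → fromChoices N (choices N x) ≡ x
fromChoices-choices zero    _ = refl
fromChoices-choices (suc N) (x , (((b₀ , b₁) , k₂) , m) , k₁)
  rewrite init-∷ʳ m (proj₁ (choices N x)) | last-∷ʳ m (proj₁ (choices N x))
        | fromChoices-choices N x = refl

choices-fromChoices : ∀ N y → choices N (fromChoices N y) ≡ y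
choices-fromChoices zero    ([] , []) = refl
choices-fromChoices (suc N) (M , (k₂ , b₁) ∷ (k₁ , b₀) ∷ u)
  rewrite choices-fromChoices N (init M , u) =
  cong (_, _) (sym (proj₂ (proj₂ (initLast M))))

choicesWeight-choices : ∀ N x →
  (columnsWeight 0 ⊞ levelsWeight) (choices N x) ≡ choicesWeight N x
choicesWeight-choices zero    _ = refl
choicesWeight-choices (suc N) (x , (((b₀ , b₁) , k₂) , m) , k₁)
  rewrite sym (choicesWeight-choices N x) | columnsWeight-∷ʳ 0 (proj₁ (choices N x)) m
        | ⌊double/2⌋ N | ⌈double/2⌉ N =
  rearrange (columnsWeight 0 (proj₁ (choices N x))) (scale m (j , j , N , N))
    (scale k₂ (j , j , j , j)) (bit (j , j , j , N) b₁)
    (scale k₁ (j , N , j , N)) (bit (j , N , N , N) b₀) (levelsWeight (proj₂ (choices N x)))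
  where
  j = suc N

  eq : ∀ c m k₂ b₁ k₁ b₀ u →
       c + m + (k₂ + (b₁ + (k₁ + (b₀ + u)))) ≡ c + u + (b₀ + b₁ + k₂ + m + k₁)
  eq = solve-∀

  rearrange : ∀ c m k₂ b₁ k₁ b₀ u →
    c ⊕ m ⊕ (k₂ ⊕ (b₁ ⊕ (k₁ ⊕ (b₀ ⊕ u)))) ≡ c ⊕ u ⊕ (b₀ ⊕ b₁ ⊕ k₂ ⊕ m ⊕ k₁)
  rearrange (c , c₁ , c₂ , c₃) (m , m₁ , m₂ , m₃) (k , k₁ , k₂ , k₃) (b , b₁ , b₂ , b₃)
            (l , l₁ , l₂ , l₃) (d , d₁ , d₂ , d₃) (u , u₁ , u₂ , u₃) =
    mon-≡ (eq c m k b l d u) (eq c₁ m₁ k₁ b₁ l₁ d₁ u₁) (eq c₂ m₂ k₂ b₂ l₂ d₂ u₂)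
          (eq c₃ m₃ k₃ b₃ l₃ d₃ u₃)

choices≈columns×levels : ∀ N → N ⊢ choicesWeight N ≈ columnsWeight {N} 0 ⊞ levelsWeight {double N}
choices≈columns×levels N = record
  { into      = choices N
  ; back      = fromChoices N
  ; weight-eq = choicesWeight-choices N
  ; back-into = fromChoices-choices N
  ; into-back = λ y _ → choices-fromChoices N y
  }

-- The infinite product is read coefficientwise, as the eventual value of its partial products.
theorem1 : (p q r s : ℕ) → ∃ λ N₀ → (N : ℕ) → N₀ ≤ N →
    Fin (partialProd N p q r s) ↔ Σ Partition (λ μ → weight μ ≡ (p , q , r , s))
-- Every truncation is controlled by the exponent of a alone, so `p` serves as the threshold.
theorem1 p q r s = p , λ N p≤N →
  ↔-trans (partialProd-counts N p q r s)
  (↔-trans (fibre-↔ (choices≈columns×levels N) p≤N)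
  -- Paths embed both in levels and in steps, so the first of these two comparisons is run
  -- backwards.
  (↔-trans (↔-sym (fibre-↔ (⊞-congʳ (paths≈levels N (double N)) (columnsWeight 0)) p≤N))
  (↔-trans (fibre-↔ (⊞-congʳ (paths≈steps N N) (columnsWeight 0)) p≤N)
  (↔-trans (fibre-↔ (columns×steps≈gaps N N) p≤N)
           (fibre-↔ (gaps≈partitions N) p≤N)))))
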